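{- Let $d\ge 1$ and $r\ge 1$ be integers and let $n=(d+1)(r-1)+1$. Let $a_1,\ldots,a_r$ be integers satisfying $a_i\le d+1$ for all $1\le i\le r$ and $\sum_{i=1}^r a_i=n$. Then there exists a set $X\subset\mathbb{R}^d$ of $n$ points such that for every Tverberg partition $X_1,\ldots,X_r$ of $X$ into $r$ parts, the cardinalities $|X_1|,\ldots,|X_r|$ are a permutation of the integers $a_1,\ldots,a_r$.
   Context: For a set $X\subset\mathbb{R}^d$ of $n=(d+1)(r-1)+1$ points, a Tverberg partition of $X$ is a partition of $X$ into $r$ pairwise disjoint subsets $X_1,\ldots,X_r$ (with union $X$) such that $\bigcap_{i=1}^r \mathrm{conv}(X_i)\neq\emptyset$, where $\mathrm{conv}$ denotes convex hull. -}

module Defs where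

open import Algebra.Bundles using (CommutativeMonoid)
open import Algebra.Bundles.Raw using (RawMonoid)
import Algebra.Definitions.RawMonoid as RawMonoidDefinitions
open import Data.Fin.Subset using (Subset; _∈_; _∉_; _∩_; Empty)
open import Data.Integer using (ℤ)
import Data.Integer as ℤ
open import Data.Nat using (ℕ; _≤_; _⊔_)
import Data.Nat.Properties as ℕ
open import Data.Product using (∃; _×_; _,_)
open import Data.Rational using (ℚ; 0ℚ; 1ℚ; ½; ∣_∣; _<_; _+_; _*_; _-_; -_; 1/_; Positive; positive)
import Data.Rational as ℚ
import Data.Rational.Properties as ℚ
open import Algebra.Properties.CommutativeSemigroup (CommutativeMonoid.commutativeSemigroup ℚ.+-0-commutativeMonoid) using (interchange)
open import Algebra.Properties.Group ℚ.+-0-group using (//-rightDividesˡ)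
open import Algebra.Properties.Ring ℚ.+-*-ring using (x[y-z]≈xy-xz)
open import Data.Vec.Functional using (Vector)
open import Data.Vec.Functional.Relation.Binary.Pointwise using (Pointwise)
open import Level using (0ℓ)
open import Relation.Binary.PropositionalEquality using (_≡_; _≢_; sym; trans; cong; cong₂; subst; module ≡-Reasoning)
open import Relation.Unary using (Pred)

-- The real numbers are Cauchy sequences of rationals, with _≃_ as equality.

Cauchy : (ℕ → ℚ) → Set
Cauchy s = ∀ ε → 0ℚ < ε → ∃ λ N → ∀ m n → N ≤ m → N ≤ n → ∣ s m - s n ∣ < ε

record ℝ : Set where
  constructor mkℝ
  field
    seq    : ℕ → ℚ
    cauchy : Cauchy seq

open ℝ public

infix 4 _≃_ _≤ℝ_

_≃_ : ℝ → ℝ → Set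
x ≃ y = ∀ ε → 0ℚ < ε → ∃ λ N → ∀ n → N ≤ n → ∣ seq x n - seq y n ∣ < ε

_≤ℝ_ : ℝ → ℝ → Set
x ≤ℝ y = ∀ ε → 0ℚ < ε → ∃ λ N → ∀ n → N ≤ n → seq x n < seq y n + ε

const-cauchy : ∀ q → Cauchy (λ _ → q)
const-cauchy q ε 0<ε =
  0 , λ _ _ _ _ → subst (_< ε) (sym (cong ∣_∣ (ℚ.+-inverseʳ q))) 0<ε

fromℚ : ℚ → ℝ
fromℚ q = mkℝ (λ _ → q) (const-cauchy q)

0ℝ 1ℝ : ℝ
0ℝ = fromℚ 0ℚ
1ℝ = fromℚ 1ℚ

private
  sum-difference : ∀ a b c d → (a + b) - (c + d) ≡ (a - c) + (b - d)
  sum-difference a b c d =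
    trans (cong ((a + b) +_) (ℚ.neg-distrib-+ c d)) (interchange a b (- c) (- d))

  sum-split : ∀ a b → a ≡ (a - b) + b
  sum-split a b = sym (//-rightDividesˡ b a)

  product-difference : ∀ a b c d → a * b - c * d ≡ a * (b - d) + d * (a - c)
  product-difference a b c d = begin
    a * b - c * d                        ≡⟨ cong (_- c * d) (sum-split (a * b) (a * d)) ⟩
    (a * b - a * d) + a * d - c * d      ≡⟨ ℚ.+-assoc (a * b - a * d) (a * d) (- (c * d)) ⟩
    (a * b - a * d) + (a * d - c * d)    ≡⟨ cong₂ (λ x y → (a * b - a * d) + (x - y)) (ℚ.*-comm a d) (ℚ.*-comm c d) ⟩
    (a * b - a * d) + (d * a - d * c)    ≡⟨ cong₂ _+_ (x[y-z]≈xy-xz a b d) (x[y-z]≈xy-xz d a c) ⟨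
    a * (b - d) + d * (a - c)            ∎
    where open ≡-Reasoning

  half-pos : ∀ ε → 0ℚ < ε → 0ℚ < ½ * ε
  half-pos ε 0<ε = subst (_< ½ * ε) (ℚ.*-zeroʳ ½) (ℚ.*-monoʳ-<-pos ½ 0<ε)

  halves : ∀ ε → ½ * ε + ½ * ε ≡ ε
  halves ε = trans (sym (ℚ.*-distribʳ-+ ε ½ ½)) (ℚ.*-identityˡ ε)

opaque
  +-cauchy : ∀ s t → Cauchy s → Cauchy t → Cauchy (λ n → s n + t n)
  +-cauchy s t cs ct ε 0<ε
    with cs (½ * ε) (half-pos ε 0<ε) | ct (½ * ε) (half-pos ε 0<ε)
  ... | M , s-close | N , t-close = M ⊔ N , λ m n M⊔N≤m M⊔N≤n →
    let open ℚ.≤-Reasoning in begin-strict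
      ∣ (s m + t m) - (s n + t n) ∣    ≡⟨ cong ∣_∣ (sum-difference (s m) (t m) (s n) (t n)) ⟩
      ∣ (s m - s n) + (t m - t n) ∣    ≤⟨ ℚ.∣p+q∣≤∣p∣+∣q∣ (s m - s n) (t m - t n) ⟩
      ∣ s m - s n ∣ + ∣ t m - t n ∣    <⟨ ℚ.+-mono-<
        (s-close m n (ℕ.m⊔n≤o⇒m≤o M N M⊔N≤m) (ℕ.m⊔n≤o⇒m≤o M N M⊔N≤n))
        (t-close m n (ℕ.m⊔n≤o⇒n≤o M N M⊔N≤m) (ℕ.m⊔n≤o⇒n≤o M N M⊔N≤n)) ⟩
      ½ * ε + ½ * ε                    ≡⟨ halves ε ⟩
      ε                                ∎

eventually-bounded : ∀ s → Cauchy s →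
  ∃ λ B → 0ℚ < B × ∃ λ N → ∀ n → N ≤ n → ∣ s n ∣ < B
eventually-bounded s cs with cs 1ℚ (ℚ.positive⁻¹ 1ℚ)
... | N , close =
  1ℚ + ∣ s N ∣ ,
  ℚ.+-mono-<-≤ (ℚ.positive⁻¹ 1ℚ) (ℚ.0≤∣p∣ (s N)) ,
  N , λ n N≤n → let open ℚ.≤-Reasoning in begin-strict
    ∣ s n ∣                    ≡⟨ cong ∣_∣ (sum-split (s n) (s N)) ⟩
    ∣ (s n - s N) + s N ∣      ≤⟨ ℚ.∣p+q∣≤∣p∣+∣q∣ (s n - s N) (s N) ⟩
    ∣ s n - s N ∣ + ∣ s N ∣    <⟨ ℚ.+-monoˡ-< ∣ s N ∣ (close n N N≤n ℕ.≤-refl) ⟩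
    1ℚ + ∣ s N ∣               ∎

private
  scaled : ∀ B → 0ℚ < B → ∀ ε → 0ℚ < ε → ∃ λ δ → 0ℚ < δ × B * δ ≡ ε
  scaled B 0<B ε 0<ε = 1/B * ε , 0<δ , Bδ≡ε
    where
    instance
      B-pos : Positive B
      B-pos = positive 0<B
      B-nonZero : ℚ.NonZero B
      B-nonZero = ℚ.pos⇒nonZero B
    1/B : ℚ
    1/B = 1/ B
    instance
      1/B-pos : Positive 1/B
      1/B-pos = ℚ.1/pos⇒pos B
    0<δ : 0ℚ < 1/B * ε
    0<δ = subst (_< 1/B * ε) (ℚ.*-zeroʳ 1/B) (ℚ.*-monoʳ-<-pos 1/B 0<ε)
    Bδ≡ε : B * (1/B * ε) ≡ ε
    Bδ≡ε = trans (sym (ℚ.*-assoc B 1/B ε))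
      (trans (cong (_* ε) (ℚ.*-inverseʳ B)) (ℚ.*-identityˡ ε))

  *-bound : ∀ {B δ} → 0ℚ < B → ∀ p q → ∣ p ∣ < B → ∣ q ∣ < δ → ∣ p * q ∣ < B * δ
  *-bound {B} {δ} 0<B p q ∣p∣<B ∣q∣<δ = begin-strict
    ∣ p * q ∣        ≡⟨ ℚ.∣p*q∣≡∣p∣*∣q∣ p q ⟩
    ∣ p ∣ * ∣ q ∣    ≤⟨ ℚ.*-monoʳ-≤-nonNeg ∣ q ∣ {{ℚ.nonNegative (ℚ.0≤∣p∣ q)}} (ℚ.<⇒≤ ∣p∣<B) ⟩
    B * ∣ q ∣        <⟨ ℚ.*-monoʳ-<-pos B {{positive 0<B}} ∣q∣<δ ⟩
    B * δ            ∎
    where open ℚ.≤-Reasoning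

opaque
  *-cauchy : ∀ s t → Cauchy s → Cauchy t → Cauchy (λ n → s n * t n)
  *-cauchy s t cs ct ε 0<ε
    with eventually-bounded s cs | eventually-bounded t ct
  ... | B , 0<B , K , s-bdd | C , 0<C , L , t-bdd
    with scaled B 0<B (½ * ε) (half-pos ε 0<ε) | scaled C 0<C (½ * ε) (half-pos ε 0<ε)
  ... | δ , 0<δ , Bδ≡ε/2 | η , 0<η , Cη≡ε/2
    with cs η 0<η | ct δ 0<δ
  ... | M , s-close | N , t-close = (K ⊔ L) ⊔ (M ⊔ N) , λ m n ≤m ≤n →
    let open ℚ.≤-Reasoning
        K⊔L≤m = ℕ.m⊔n≤o⇒m≤o (K ⊔ L) (M ⊔ N) ≤m
        K⊔L≤n = ℕ.m⊔n≤o⇒m≤o (K ⊔ L) (M ⊔ N) ≤n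
        M⊔N≤m = ℕ.m⊔n≤o⇒n≤o (K ⊔ L) (M ⊔ N) ≤m
        M⊔N≤n = ℕ.m⊔n≤o⇒n≤o (K ⊔ L) (M ⊔ N) ≤n
    in begin-strict
      ∣ s m * t m - s n * t n ∣
        ≡⟨ cong ∣_∣ (product-difference (s m) (t m) (s n) (t n)) ⟩
      ∣ s m * (t m - t n) + t n * (s m - s n) ∣
        ≤⟨ ℚ.∣p+q∣≤∣p∣+∣q∣ (s m * (t m - t n)) (t n * (s m - s n)) ⟩
      ∣ s m * (t m - t n) ∣ + ∣ t n * (s m - s n) ∣
        <⟨ ℚ.+-mono-<
          (*-bound 0<B (s m) (t m - t n) (s-bdd m (ℕ.m⊔n≤o⇒m≤o K L K⊔L≤m))
            (t-close m n (ℕ.m⊔n≤o⇒n≤o M N M⊔N≤m) (ℕ.m⊔n≤o⇒n≤o M N M⊔N≤n)))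
          (*-bound 0<C (t n) (s m - s n) (t-bdd n (ℕ.m⊔n≤o⇒n≤o K L K⊔L≤n))
            (s-close m n (ℕ.m⊔n≤o⇒m≤o M N M⊔N≤m) (ℕ.m⊔n≤o⇒m≤o M N M⊔N≤n))) ⟩
      B * δ + C * η
        ≡⟨ cong₂ _+_ Bδ≡ε/2 Cη≡ε/2 ⟩
      ½ * ε + ½ * ε
        ≡⟨ halves ε ⟩
      ε ∎

infixl 6 _+ℝ_
infixl 7 _*ℝ_

_+ℝ_ : ℝ → ℝ → ℝ
x +ℝ y = mkℝ (λ n → seq x n + seq y n) (+-cauchy (seq x) (seq y) (cauchy x) (cauchy y))

_*ℝ_ : ℝ → ℝ → ℝ
x *ℝ y = mkℝ (λ n → seq x n * seq y n) (*-cauchy (seq x) (seq y) (cauchy x) (cauchy y))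

+ℝ-0ℝ-rawMonoid : RawMonoid 0ℓ 0ℓ
+ℝ-0ℝ-rawMonoid = record { Carrier = ℝ ; _≈_ = _≃_ ; _∙_ = _+ℝ_ ; ε = 0ℝ }

sumℝ : ∀ {n} → Vector ℝ n → ℝ
sumℝ = RawMonoidDefinitions.sum +ℝ-0ℝ-rawMonoid

sumℤ : ∀ {n} → Vector ℤ n → ℤ
sumℤ = RawMonoidDefinitions.sum ℤ.+-0-rawMonoid

Point : ℕ → Set
Point d = Vector ℝ d

infix 4 _≋_

_≋_ : ∀ {d} → Point d → Point d → Set
_≋_ = Pointwise _≃_

-- The convex hull of { X i ∣ i ∈ S }: all convex combinations of these points.
conv : ∀ {d n} → Vector (Point d) n → Subset n → Pred (Point d) 0ℓ
conv {d} {n} X S p = ∃ λ (w : Vector ℝ n) →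
  (∀ i → 0ℝ ≤ℝ w i) ×
  (∀ i → i ∉ S → w i ≃ 0ℝ) ×
  sumℝ w ≃ 1ℝ ×
  (λ c → sumℝ (λ i → w i *ℝ X i c)) ≋ p

-- The parts are subsets of the index set of X; X is meant to be injective, so
-- these are the subsets of the point set. The common point makes every part
-- nonempty.
record TverbergPartition {d n r : ℕ} (X : Vector (Point d) n) (P : Vector (Subset n) r) : Set where
  field
    disjoint : ∀ k l → k ≢ l → Empty (P k ∩ P l)
    covers   : ∀ i → ∃ λ k → i ∈ P k
    meet     : ∃ λ p → ∀ k → conv X (P k) p

{-# OPTIONS --safe #-}
module Submission where

-- Since Σ aᵢ = n, the codimensions bᵢ = d + 1 − aᵢ are nonnegative with sum d.
-- Colour the coordinates by β so that bᵢ of them get colour i. The points are the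
-- multiples e_c, 2 e_c, …, (r − 1) e_c on each coordinate axis and, for each i, a
-- centre fᵢ that is a negative multiple of the sum of the e_c with β c ≠ i.
--
-- Let p be a common point of the hulls. Only r − 1 points have a positive c-th
-- coordinate, so some part has none and p_c ≤ 0. A part without centres lies in
-- {Σ x_c ≥ 1}, so each part has a centre, hence exactly one. The part of the
-- centre of colour β c has nonnegative c-th coordinates, so p_c ≥ 0 and p = 0.
-- A part with centre fᵢ and no point on the axis c, β c ≠ i, is separated from 0,
-- so it meets all those axes and has at least 1 + d − bᵢ = aᵢ points. As the parts
-- are disjoint, all these bounds are attained.
--
-- In the code the number of parts is suc r, so each axis carries r points.

open import Defs
open import Algebra.Bundles using (AbelianGroup; CommutativeRing)
import Algebra.Properties.AbelianGroup as AbelianGroupProperties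
import Algebra.Properties.CommutativeSemigroup as CommutativeSemigroupProperties
import Algebra.Properties.Group as GroupProperties
import Algebra.Properties.Semiring.Sum as SemiringSum
open import Data.Bool using (if_then_else_)
open import Data.Fin using (Fin; zero; suc; toℕ; _≟_; _↑ˡ_; _↑ʳ_; splitAt; combine; punchOut)
open import Data.Fin.Permutation using (Permutation′; permutation; _⟨$⟩ʳ_)
import Data.Fin.Properties as Fin
open import Data.Fin.Subset using (Subset; ∣_∣; _∈_; inside; outside)
open import Data.Fin.Subset.Properties using (_∈?_; x∈p∩q⁺)
import Data.Integer as ℤ
import Data.Integer.Properties as ℤ
open import Data.Nat using (ℕ; zero; suc)
import Data.Nat as ℕ
import Data.Nat.Properties as ℕ
open import Data.Nat.Solver renaming (module +-*-Solver to ℕ-Solver)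
open import Data.Product using (∃; _×_; _,_; proj₁; proj₂)
open import Data.Rational using (ℚ; 0ℚ; 1ℚ; ½; 1/_)
import Data.Rational as ℚ
import Data.Rational.Properties as ℚ
open import Data.Rational.Solver renaming (module +-*-Solver to ℚ-Solver)
open import Data.Sum using (_⊎_; inj₁; inj₂; [_,_]′)
open import Data.Sum.Function.Propositional using (_⊎-↔_)
open import Data.Vec using ([]; _∷_)
open import Data.Vec.Functional using (Vector)
import Data.Vec.Functional as Vector
open import Function using (_∘_; _↔_; Inverse)
open import Function.Construct.Composition using (_↔-∘_)
open import Function.Construct.Identity using (↔-id)
open import Function.Definitions using (Injective)
open import Relation.Binary.PropositionalEquality
open import Relation.Nullary using (¬_; Dec; yes; no; does; contradiction)

open AbelianGroupProperties ℚ.+-0-abelianGroup using ()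
  renaming (xyx⁻¹≈y to p+q-p≡q)
open GroupProperties ℚ.+-0-group using ()
  renaming (⁻¹-involutive to ℚ-neg-involutive; ∙-cancelˡ to ℚ-+-cancelˡ)
open AbelianGroupProperties ℤ.+-0-abelianGroup using ()
  renaming (xyx⁻¹≈y to i+j-i≡j)
open GroupProperties (AbelianGroup.group ℤ.+-0-abelianGroup) using ()
  renaming (∙-cancelʳ to ℤ-+-cancelʳ)
open CommutativeSemigroupProperties ℤ.+-commutativeSemigroup using ()
  renaming (interchange to ℤ-interchange)
open SemiringSum (CommutativeRing.semiring ℚ.+-*-commutativeRing) using ()
  renaming (sum to sumℚ; ∑-distrib-+ to sumℚ-distrib-+; sum-cong-≗ to sumℚ-cong;
            sum-replicate-zero to sumℚ-zero)
open SemiringSum ℕ.+-*-semiring using ()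
  renaming (sum to sumℕ; ∑-distrib-+ to sumℕ-distrib-+; sum-cong-≗ to sumℕ-cong;
            ∑-comm to sumℕ-comm; sum-permute to sumℕ-permute)

-- Limits of rational sequences, and affine functions on convex hulls.

module _ where
  open import Data.Rational using (_+_; _*_; _-_; -_; _≤_; _<_)
  open ℚ-Solver using (solve; _:=_; _:+_; _:*_; _:-_; :-_; con)

  sumℚ-neg : ∀ {n} (t : Vector ℚ n) → sumℚ (λ i → - t i) ≡ - sumℚ t
  sumℚ-neg {zero}  t = refl
  sumℚ-neg {suc n} t =
    trans (cong (- t zero +_) (sumℚ-neg (t ∘ suc))) (sym (ℚ.neg-distrib-+ (t zero) _))

  sumℚ-nonNeg : ∀ {n} (t : Vector ℚ n) → (∀ i → 0ℚ ≤ t i) → 0ℚ ≤ sumℚ t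
  sumℚ-nonNeg {zero}  t 0≤t = ℚ.≤-refl
  sumℚ-nonNeg {suc n} t 0≤t = ℚ.+-mono-≤ (0≤t zero) (sumℚ-nonNeg (t ∘ suc) (0≤t ∘ suc))

  term≤sumℚ : ∀ {n} (t : Vector ℚ n) → (∀ i → 0ℚ ≤ t i) → ∀ i → t i ≤ sumℚ t
  term≤sumℚ t 0≤t zero    = subst (_≤ sumℚ t) (ℚ.+-identityʳ (t zero))
    (ℚ.+-monoʳ-≤ (t zero) (sumℚ-nonNeg (t ∘ suc) (0≤t ∘ suc)))
  term≤sumℚ t 0≤t (suc i) = subst (_≤ sumℚ t) (ℚ.+-identityˡ (t (suc i)))
    (ℚ.+-mono-≤ (0≤t zero) (term≤sumℚ (t ∘ suc) (0≤t ∘ suc) i))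

  0≤q-p : ∀ {p q} → p ≤ q → 0ℚ ≤ q - p
  0≤q-p {p} {q} p≤q = subst (_≤ q - p) (ℚ.+-inverseʳ p) (ℚ.+-monoˡ-≤ (- p) p≤q)

  0≤-p : ∀ {p} → p ≤ 0ℚ → 0ℚ ≤ - p
  0≤-p = ℚ.neg-antimono-≤

  -- For s = seq x this is 0ℝ ≤ℝ x; the sequences need not be Cauchy.
  record NonNeg (s : ℕ → ℚ) : Set where
    constructor nonNeg
    field
      eventually : ∀ ε → 0ℚ < ε → ∃ λ N → ∀ n → N ℕ.≤ n → 0ℚ < s n + ε

  open NonNeg

  -- Convergence to 0, kept as two one-sided bounds so that each half feeds directly into the sign
  -- arguments.
  Null : (ℕ → ℚ) → Set
  Null s = NonNeg s × NonNeg (λ n → - s n)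

  NonNeg-resp-≗ : ∀ {s t} → s ≗ t → NonNeg s → NonNeg t
  NonNeg-resp-≗ s≗t s≥0 .eventually ε 0<ε with eventually s≥0 ε 0<ε
  ... | N , bound = N , λ n N≤n → subst (λ q → 0ℚ < q + ε) (s≗t n) (bound n N≤n)

  Null-resp-≗ : ∀ {s t} → s ≗ t → Null s → Null t
  Null-resp-≗ s≗t (s≥0 , s≤0) =
    NonNeg-resp-≗ s≗t s≥0 , NonNeg-resp-≗ (λ n → cong -_ (s≗t n)) s≤0

  NonNeg-const : ∀ {q} → 0ℚ ≤ q → NonNeg (λ _ → q)
  NonNeg-const 0≤q .eventually ε 0<ε = 0 , λ _ _ → ℚ.+-mono-≤-< 0≤q 0<ε

  ¬NonNeg-const : ∀ {q} → q < 0ℚ → ¬ NonNeg (λ _ → q)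
  ¬NonNeg-const {q} q<0 q≥0 with eventually q≥0 (- q) (ℚ.neg-antimono-< q<0)
  ... | N , bound = ℚ.<-irrefl (sym (ℚ.+-inverseʳ q)) (bound N ℕ.≤-refl)

  NonNeg-+ : ∀ {s t} → NonNeg s → NonNeg t → NonNeg (λ n → s n + t n)
  NonNeg-+ {s} {t} s≥0 t≥0 .eventually ε 0<ε
    with eventually s≥0 (½ * ε) 0<½ε | eventually t≥0 (½ * ε) 0<½ε
    where
    0<½ε : 0ℚ < ½ * ε
    0<½ε = subst (_< ½ * ε) (ℚ.*-zeroʳ ½) (ℚ.*-monoʳ-<-pos ½ 0<ε)
  ... | M , s-bound | N , t-bound = M ℕ.⊔ N , λ n M⊔N≤n → subst (0ℚ <_)
    (solve 3 (λ x y e → (x :+ con ½ :* e) :+ (y :+ con ½ :* e) := (x :+ y) :+ e) refl (s n) (t n) ε)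
    (ℚ.+-mono-< (s-bound n (ℕ.m⊔n≤o⇒m≤o M N M⊔N≤n)) (t-bound n (ℕ.m⊔n≤o⇒n≤o M N M⊔N≤n)))

  NonNeg-sum : ∀ {m} (s : Fin m → ℕ → ℚ) → (∀ i → NonNeg (s i)) →
    NonNeg (λ n → sumℚ (λ i → s i n))
  NonNeg-sum {zero}  s s≥0 = NonNeg-const ℚ.≤-refl
  NonNeg-sum {suc m} s s≥0 = NonNeg-+ (s≥0 zero) (NonNeg-sum (s ∘ suc) (s≥0 ∘ suc))

  opaque
    -- Dividing by c + 1 avoids a separate case c = 0, and the η left over restores the strict
    -- inequality that is lost when multiplying by a merely nonnegative c.
    scaled-margin : ∀ {c ε} → 0ℚ ≤ c → 0ℚ < ε → ∃ λ η → 0ℚ < η × c * η + η ≡ ε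
    scaled-margin {c} {ε} 0≤c 0<ε = η , 0<η , cη+η≡ε
      where
      instance
        c+1-pos : ℚ.Positive (c + 1ℚ)
        c+1-pos = ℚ.positive (ℚ.+-mono-≤-< 0≤c (ℚ.positive⁻¹ 1ℚ))
        c+1-nonZero : ℚ.NonZero (c + 1ℚ)
        c+1-nonZero = ℚ.pos⇒nonZero (c + 1ℚ)
        1/c+1-pos : ℚ.Positive (1/ (c + 1ℚ))
        1/c+1-pos = ℚ.1/pos⇒pos (c + 1ℚ)
      η : ℚ
      η = 1/ (c + 1ℚ) * ε
      0<η : 0ℚ < η
      0<η = subst (_< η) (ℚ.*-zeroʳ (1/ (c + 1ℚ))) (ℚ.*-monoʳ-<-pos (1/ (c + 1ℚ)) 0<ε)
      cη+η≡ε : c * η + η ≡ ε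
      cη+η≡ε = begin
        c * η + η                        ≡⟨ solve 2 (λ c h → c :* h :+ h := (c :+ con 1ℚ) :* h) refl c η ⟩
        (c + 1ℚ) * (1/ (c + 1ℚ) * ε)     ≡⟨ ℚ.*-assoc (c + 1ℚ) (1/ (c + 1ℚ)) ε ⟨
        (c + 1ℚ) * 1/ (c + 1ℚ) * ε       ≡⟨ cong (_* ε) (ℚ.*-inverseʳ (c + 1ℚ)) ⟩
        1ℚ * ε                           ≡⟨ ℚ.*-identityˡ ε ⟩
        ε                                ∎
        where open ≡-Reasoning

  NonNeg-scale : ∀ {s c} → 0ℚ ≤ c → NonNeg s → NonNeg (λ n → s n * c)
  NonNeg-scale {s} {c} 0≤c s≥0 .eventually ε 0<ε with scaled-margin 0≤c 0<ε
  ... | η , 0<η , cη+η≡ε with eventually s≥0 η 0<η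
  ... | N , bound = N , λ n N≤n → begin-strict
    0ℚ                     ≡⟨ ℚ.*-zeroˡ c ⟨
    0ℚ * c                 ≤⟨ ℚ.*-monoʳ-≤-nonNeg c {{ℚ.nonNegative 0≤c}} (ℚ.<⇒≤ (bound n N≤n)) ⟩
    (s n + η) * c          ≡⟨ ℚ.*-distribʳ-+ c (s n) η ⟩
    s n * c + η * c        ≡⟨ cong (s n * c +_) (ℚ.*-comm η c) ⟩
    s n * c + c * η        ≡⟨ ℚ.+-identityʳ (s n * c + c * η) ⟨
    s n * c + c * η + 0ℚ   <⟨ ℚ.+-monoʳ-< (s n * c + c * η) 0<η ⟩
    s n * c + c * η + η    ≡⟨ ℚ.+-assoc (s n * c) (c * η) η ⟩
    s n * c + (c * η + η)  ≡⟨ cong (s n * c +_) cη+η≡ε ⟩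
    s n * c + ε            ∎
    where open ℚ.≤-Reasoning

  -- A point outside a part has a weight that only tends to 0, and a functional may take either sign
  -- there. A negative factor c is handled by scaling the other half of `Null` by - c.
  Null⇒NonNeg-scale : ∀ {s} c → Null s → NonNeg (λ n → s n * c)
  Null⇒NonNeg-scale {s} c (s≥0 , s≤0) with ℚ.≤-total 0ℚ c
  ... | inj₁ 0≤c = NonNeg-scale 0≤c s≥0
  ... | inj₂ c≤0 = NonNeg-resp-≗
    (λ n → solve 2 (λ x c → (:- x) :* (:- c) := x :* c) refl (s n) c)
    (NonNeg-scale (0≤-p c≤0) s≤0)

  Null-+ : ∀ {s t} → Null s → Null t → Null (λ n → s n + t n)
  Null-+ {s} {t} (s≥0 , s≤0) (t≥0 , t≤0) =
    NonNeg-+ s≥0 t≥0 ,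
    NonNeg-resp-≗ (λ n → sym (ℚ.neg-distrib-+ (s n) (t n))) (NonNeg-+ s≤0 t≤0)

  Null-neg : ∀ {s} → Null s → Null (λ n → - s n)
  Null-neg {s} (s≥0 , s≤0) = s≤0 , NonNeg-resp-≗ (λ n → sym (ℚ-neg-involutive (s n))) s≥0

  Null-sum : ∀ {m} (s : Fin m → ℕ → ℚ) → (∀ i → Null (s i)) →
    Null (λ n → sumℚ (λ i → s i n))
  Null-sum s s≈0 =
    NonNeg-sum s (proj₁ ∘ s≈0) ,
    NonNeg-resp-≗ (λ n → sumℚ-neg (λ i → s i n))
      (NonNeg-sum (λ i n → - s i n) (proj₂ ∘ s≈0))

  p≤∣p∣ : ∀ p → p ≤ ℚ.∣ p ∣
  p≤∣p∣ p with ℚ.≤-total 0ℚ p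
  ... | inj₁ 0≤p = ℚ.≤-reflexive (sym (ℚ.0≤p⇒∣p∣≡p 0≤p))
  ... | inj₂ p≤0 = ℚ.≤-trans p≤0 (ℚ.0≤∣p∣ p)

  ≃⇒Null : ∀ {x y} → x ≃ y → Null (λ n → seq x n - seq y n)
  ≃⇒Null {x} {y} x≃y = nonNeg x≥y , nonNeg x≤y
    where
    positive-gap : ∀ {p ε} → p < ε → 0ℚ < - p + ε
    positive-gap {p} {ε} p<ε = subst (_< - p + ε) (ℚ.+-inverseˡ p) (ℚ.+-monoʳ-< (- p) p<ε)
    x≤y : ∀ ε → 0ℚ < ε → ∃ λ N → ∀ n → N ℕ.≤ n → 0ℚ < - (seq x n - seq y n) + ε
    x≤y ε 0<ε with x≃y ε 0<ε
    ... | N , close = N , λ n N≤n → positive-gap (ℚ.≤-<-trans (p≤∣p∣ _) (close n N≤n))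
    x≥y : ∀ ε → 0ℚ < ε → ∃ λ N → ∀ n → N ℕ.≤ n → 0ℚ < (seq x n - seq y n) + ε
    x≥y ε 0<ε with x≃y ε 0<ε
    ... | N , close = N , λ n N≤n → subst (λ q → 0ℚ < q + ε) (ℚ-neg-involutive (seq x n - seq y n))
      (positive-gap (ℚ.≤-<-trans
        (subst (- (seq x n - seq y n) ≤_) (ℚ.∣-p∣≡∣p∣ (seq x n - seq y n)) (p≤∣p∣ _))
        (close n N≤n)))

  fromℚ-injective : ∀ {p q} → fromℚ p ≃ fromℚ q → p ≡ q
  fromℚ-injective {p} {q} p≃q = begin
    p              ≡⟨ solve 2 (λ p q → p := (p :- q) :+ q) refl p q ⟩
    (p - q) + q    ≡⟨ cong (_+ q) p-q≡0 ⟩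
    0ℚ + q         ≡⟨ ℚ.+-identityˡ q ⟩
    q              ∎
    where
    open ≡-Reasoning
    p-q≡0 : p - q ≡ 0ℚ
    p-q≡0 with 0ℚ ℚ.<? ℚ.∣ p - q ∣
    ... | no  ∣p-q∣≤0 = ℚ.∣p∣≡0⇒p≡0 (p - q) (ℚ.≤-antisym (ℚ.≮⇒≥ ∣p-q∣≤0) (ℚ.0≤∣p∣ (p - q)))
    -- With the distance itself as ε, the constant sequences would be closer than their distance.
    ... | yes 0<∣p-q∣ with p≃q ℚ.∣ p - q ∣ 0<∣p-q∣
    ...   | N , close = contradiction (close N ℕ.≤-refl) (ℚ.<-irrefl refl)

  seq-sumℝ : ∀ {n} (v : Vector ℝ n) m → seq (sumℝ v) m ≡ sumℚ (λ i → seq (v i) m)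
  seq-sumℝ {zero}  v m = refl
  seq-sumℝ {suc n} v m = cong (seq (v zero) m +_) (seq-sumℝ (v ∘ suc) m)

  module _ {n} (w : Vector ℝ n) where

    -- The functionals in use have rational values at the points, so only the weights depend on m.
    mean : Vector ℚ n → ℕ → ℚ
    mean y m = sumℚ (λ i → seq (w i) m * y i)

    mean-+ : ∀ y z m → mean (λ i → y i + z i) m ≡ mean y m + mean z m
    mean-+ y z m = trans
      (sumℚ-cong (λ i → ℚ.*-distribˡ-+ (seq (w i) m) (y i) (z i)))
      (sumℚ-distrib-+ (λ i → seq (w i) m * y i) (λ i → seq (w i) m * z i))

    mean-neg : ∀ y m → mean (λ i → - y i) m ≡ - mean y m
    mean-neg y m = trans
      (sumℚ-cong (λ i → sym (ℚ.neg-distribʳ-* (seq (w i) m) (y i))))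
      (sumℚ-neg (λ i → seq (w i) m * y i))

    mean-0 : ∀ m → mean (λ _ → 0ℚ) m ≡ 0ℚ
    mean-0 m = trans (sumℚ-cong (λ i → ℚ.*-zeroʳ (seq (w i) m))) (sumℚ-zero n)

    -- q is the value at the convex combination with weights w of an affine
    -- function taking the value y i at the i-th point.
    record Extends (y : Vector ℚ n) (q : ℕ → ℚ) : Set where
      constructor extends
      field
        mean≃ : Null (λ m → mean y m - q m)

    Extends-+ : ∀ {y q z r} → Extends y q → Extends z r →
      Extends (λ i → y i + z i) (λ m → q m + r m)
    Extends-+ {y} {q} {z} {r} (extends ey) (extends ez) = extends (Null-resp-≗
      (λ m → trans
        (solve 4 (λ a b c d → (a :- b) :+ (c :- d) := (a :+ c) :- (b :+ d)) refl
          (mean y m) (q m) (mean z m) (r m))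
        (cong (_- (q m + r m)) (sym (mean-+ y z m))))
      (Null-+ ey ez))

    Extends-neg : ∀ {y q} → Extends y q → Extends (λ i → - y i) (λ m → - q m)
    Extends-neg {y} {q} (extends ey) = extends (Null-resp-≗
      (λ m → trans (ℚ.neg-distrib-+ (mean y m) (- q m))
        (cong (_- - q m) (sym (mean-neg y m))))
      (Null-neg ey))

    Extends-sum : ∀ {d} {y : Vector (Vector ℚ n) d} {q : Fin d → ℕ → ℚ} →
      (∀ c → Extends (y c) (q c)) →
      Extends (λ i → sumℚ (λ c → y c i)) (λ m → sumℚ (λ c → q c m))
    Extends-sum {zero}  e = extends (Null-resp-≗ (λ m → cong (_- 0ℚ) (sym (mean-0 m)))
      (NonNeg-const ℚ.≤-refl , NonNeg-const ℚ.≤-refl))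
    Extends-sum {suc d} e = Extends-+ (e zero) (Extends-sum (e ∘ suc))

    module _ {S : Subset n} (w≥0 : ∀ i → 0ℝ ≤ℝ w i) (w≃0 : ∀ i → ¬ i ∈ S → w i ≃ 0ℝ) where

      -- Every separation argument below rests on this. Over S both factors of a term are
      -- nonnegative in the limit, and the other terms tend to 0 whatever the sign of y, so the mean
      -- is nonnegative in the limit and q with it.
      Extends-nonNeg : ∀ {y q} → Extends y q → (∀ i → i ∈ S → 0ℚ ≤ y i) → NonNeg q
      Extends-nonNeg {y} {q} (extends (_ , mean≤q)) y≥0 = NonNeg-resp-≗
        (λ m → solve 2 (λ a b → (:- (a :- b)) :+ a := b) refl (mean y m) (q m))
        (NonNeg-+ mean≤q (NonNeg-sum _ term≥0))
        where
        term≥0 : ∀ i → NonNeg (λ m → seq (w i) m * y i)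
        term≥0 i with i ∈? S
        ... | yes i∈S = NonNeg-scale {seq (w i)} (y≥0 i i∈S) (nonNeg (w≥0 i))
        ... | no  i∉S = Null⇒NonNeg-scale (y i)
          (Null-resp-≗ (λ m → ℚ.+-identityʳ (seq (w i) m)) (≃⇒Null {w i} {0ℝ} (w≃0 i i∉S)))

    module _ {d} {x : Vector (Vector ℚ d) n} {p : Point d} where

      Extends-coordinate : (λ c → sumℝ (λ i → w i *ℝ fromℚ (x i c))) ≋ p →
        ∀ c → Extends (λ i → x i c) (seq (p c))
      Extends-coordinate wx≋p c = extends (Null-resp-≗
        (λ m → cong (_- seq (p c) m) (seq-sumℝ (λ i → w i *ℝ fromℚ (x i c)) m))
        (≃⇒Null {sumℝ (λ i → w i *ℝ fromℚ (x i c))} {p c} (wx≋p c)))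

    -- This is where the total weight 1 enters; it makes constants available, hence affine and not
    -- only linear functionals.
    Extends-1 : sumℝ w ≃ 1ℝ → Extends (λ _ → 1ℚ) (λ _ → 1ℚ)
    Extends-1 w≃1 = extends (Null-resp-≗
      (λ m → cong (_- 1ℚ) (trans (seq-sumℝ w m)
        (sumℚ-cong (λ i → sym (ℚ.*-identityʳ (seq (w i) m))))))
      (≃⇒Null {sumℝ w} {1ℝ} w≃1))

-- Injective self-maps of a finite set.

injective⇒surjective : ∀ {n} {f : Fin n → Fin n} → Injective _≡_ _≡_ f → ∀ j → ∃ λ i → f i ≡ j
injective⇒surjective {suc n} {f} f-inj j with Fin.any? (λ i → f i ≟ j)
... | yes hit  = hit
-- Deleting the missed value j with `punchOut` would inject `Fin (suc n)` into `Fin n`.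
... | no  miss = contradiction
  (Fin.injective⇒≤ {f = λ i → punchOut (j≢f i)}
    (λ {i} {i′} eq → f-inj (Fin.punchOut-injective (j≢f i) (j≢f i′) eq)))
  ℕ.1+n≰n
  where
  j≢f : ∀ i → j ≢ f i
  j≢f i j≡fi = miss (i , sym j≡fi)

injective⇒permutation : ∀ {n} {f : Fin n → Fin n} → Injective _≡_ _≡_ f →
  ∃ λ (σ : Permutation′ n) → ∀ i → σ ⟨$⟩ʳ i ≡ f i
injective⇒permutation {f = f} f-inj =
  permutation f (proj₁ ∘ onto) (proj₂ ∘ onto) (λ i → f-inj (proj₂ (onto (f i)))) , λ _ → refl
  where
  onto = injective⇒surjective f-inj

-- Sums of natural numbers, cardinalities and colourings.

module _ where
  open import Data.Nat using (_+_; _*_; _≤_; z≤n; s≤s)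

  indicator : ∀ {a} {A : Set a} → Dec A → ℕ
  indicator A? = if does A? then 1 else 0

  1≤indicator : ∀ {a} {A : Set a} (A? : Dec A) → A → 1 ≤ indicator A?
  1≤indicator (yes _) _ = ℕ.≤-refl
  1≤indicator (no ¬a) a = contradiction a ¬a

  sumℕ-const : ∀ n {t : Vector ℕ n} {c} → (∀ i → t i ≡ c) → sumℕ t ≡ n * c
  sumℕ-const zero    t≡c = refl
  sumℕ-const (suc n) t≡c = cong₂ _+_ (t≡c zero) (sumℕ-const n (t≡c ∘ suc))

  sumℕ-zero : ∀ {n} {t : Vector ℕ n} → (∀ i → t i ≡ 0) → sumℕ t ≡ 0
  sumℕ-zero {n} t≡0 = trans (sumℕ-const n t≡0) (ℕ.*-zeroʳ n)

  sumℕ-mono-≤ : ∀ {n} {s t : Vector ℕ n} → (∀ i → s i ≤ t i) → sumℕ s ≤ sumℕ t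
  sumℕ-mono-≤ {zero}  s≤t = z≤n
  sumℕ-mono-≤ {suc n} s≤t = ℕ.+-mono-≤ (s≤t zero) (sumℕ-mono-≤ (s≤t ∘ suc))

  term≤sumℕ : ∀ {n} (t : Vector ℕ n) i → t i ≤ sumℕ t
  term≤sumℕ t zero    = ℕ.m≤m+n (t zero) _
  term≤sumℕ t (suc i) = ℕ.≤-trans (term≤sumℕ (t ∘ suc) i) (ℕ.m≤n+m _ (t zero))

  -- If one term were strictly smaller, the termwise bounds on the others could not make up for it.
  -- This later turns the lower bounds on the part sizes into equalities.
  sumℕ-tight : ∀ {n} {s t : Vector ℕ n} → (∀ i → s i ≤ t i) → sumℕ t ≤ sumℕ s → s ≗ t
  sumℕ-tight {suc n} {s} {t} s≤t Σt≤Σs zero = ℕ.≤-antisym (s≤t zero)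
    (ℕ.+-cancelʳ-≤ (sumℕ (t ∘ suc)) (t zero) (s zero)
      (ℕ.≤-trans Σt≤Σs (ℕ.+-monoʳ-≤ (s zero) (sumℕ-mono-≤ (s≤t ∘ suc)))))
  sumℕ-tight {suc n} {s} {t} s≤t Σt≤Σs (suc i) = sumℕ-tight (s≤t ∘ suc)
    (ℕ.+-cancelˡ-≤ (t zero) _ _ (ℕ.≤-trans Σt≤Σs (ℕ.+-monoˡ-≤ _ (s≤t zero)))) i

  sumℕ-split : ∀ m {n} (t : Vector ℕ (m + n)) →
    sumℕ t ≡ sumℕ (λ i → t (i ↑ˡ n)) + sumℕ (λ i → t (m ↑ʳ i))
  sumℕ-split zero    t = refl
  sumℕ-split (suc m) t = trans (cong (t zero +_) (sumℕ-split m (t ∘ suc))) (sym (ℕ.+-assoc (t zero) _ _))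

  sumℕ-combine : ∀ m {n} (t : Vector ℕ (m * n)) →
    sumℕ t ≡ sumℕ (λ i → sumℕ (λ j → t (combine {m} {n} i j)))
  sumℕ-combine zero    t = refl
  sumℕ-combine (suc m) {n} t = trans (sumℕ-split n t)
    (cong (sumℕ (λ j → t (j ↑ˡ (m * n))) +_) (sumℕ-combine m (λ i → t (n ↑ʳ i))))

  ∣p∣≡sum : ∀ {n} (p : Subset n) → ∣ p ∣ ≡ sumℕ (λ i → indicator (i ∈? p))
  ∣p∣≡sum []            = refl
  ∣p∣≡sum (inside  ∷ p) = cong suc (∣p∣≡sum p)
  ∣p∣≡sum (outside ∷ p) = ∣p∣≡sum p

  -- A point lies in at most one part, so swapping the double sum of the
  -- indicators bounds it by the number of points.
  sum∣disjoint∣≤n : ∀ {n r} (P : Vector (Subset n) r) →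
    (∀ {i k l} → i ∈ P k → i ∈ P l → k ≡ l) → sumℕ (λ k → ∣ P k ∣) ≤ n
  sum∣disjoint∣≤n {n} P unique = begin
    sumℕ (λ k → ∣ P k ∣)                              ≡⟨ sumℕ-cong (λ k → ∣p∣≡sum (P k)) ⟩
    sumℕ (λ k → sumℕ (λ i → indicator (i ∈? P k)))    ≡⟨ sumℕ-comm (λ k i → indicator (i ∈? P k)) ⟩
    sumℕ (λ i → sumℕ (λ k → indicator (i ∈? P k)))    ≤⟨ sumℕ-mono-≤ (λ i → at-most-one (λ k → i ∈? P k) unique) ⟩
    sumℕ {n} (λ _ → 1)                                ≡⟨ sumℕ-const n (λ _ → refl) ⟩
    n * 1                                             ≡⟨ ℕ.*-identityʳ n ⟩
    n                                                 ∎
    where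
    open ℕ.≤-Reasoning
    at-most-one : ∀ {m} {A : Fin m → Set} (A? : ∀ k → Dec (A k)) →
      (∀ {k l} → A k → A l → k ≡ l) → sumℕ (λ k → indicator (A? k)) ≤ 1
    at-most-one {zero}  A? unique = z≤n
    at-most-one {suc m} A? unique with A? zero
    ... | no  _ = at-most-one (A? ∘ suc) (λ a b → Fin.suc-injective (unique a b))
    ... | yes a = s≤s (ℕ.≤-reflexive (sumℕ-zero none))
      where
      none : ∀ k → indicator (A? (suc k)) ≡ 0
      none k with A? (suc k)
      ... | yes b = contradiction (unique a b) λ ()
      ... | no  _ = refl

  -- `Fin (sumℕ b)` is cut into consecutive blocks of lengths b i, one per colour: the first b₀
  -- elements get `zero`, and the rest get the recursive colours shifted by `suc`.
  colouring : ∀ {r d} (b : Vector ℕ r) → d ≡ sumℕ b →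
    ∃ λ (β : Fin d → Fin r) → ∀ i → sumℕ (λ j → indicator (β j ≟ i)) ≡ b i
  colouring {zero}  b refl = (λ ()) , λ ()
  colouring {suc r} b refl with colouring (b ∘ suc) refl
  ... | β , count = γ , γ-count
    where
    b₀ = b zero
    γ′ : Fin b₀ ⊎ Fin (sumℕ (b ∘ suc)) → Fin (suc r)
    γ′ = [ (λ _ → zero) , suc ∘ β ]′
    γ : Fin (sumℕ b) → Fin (suc r)
    γ j = γ′ (splitAt b₀ j)
    hits : Fin (suc r) → Vector ℕ (sumℕ b)
    hits i j = indicator (γ j ≟ i)
    γ-split : ∀ i → sumℕ (hits i) ≡
      sumℕ {b₀} (λ _ → indicator (zero ≟ i)) + sumℕ (λ j → indicator (suc (β j) ≟ i))
    γ-split i = trans (sumℕ-split b₀ (hits i)) (cong₂ _+_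
      (sumℕ-cong (λ j → cong (λ z → indicator (γ′ z ≟ i)) (Fin.splitAt-↑ˡ b₀ j _)))
      (sumℕ-cong (λ j → cong (λ z → indicator (γ′ z ≟ i)) (Fin.splitAt-↑ʳ b₀ _ j))))
    γ-count : ∀ i → sumℕ (hits i) ≡ b i
    γ-count zero = trans (γ-split zero) (trans
      (cong₂ _+_ (sumℕ-const b₀ (λ _ → refl)) (sumℕ-zero {t = λ j → indicator (suc (β j) ≟ zero)} (λ _ → refl)))
      (trans (ℕ.+-identityʳ (b₀ * 1)) (ℕ.*-identityʳ b₀)))
    γ-count (suc i) = trans (γ-split (suc i))
      (trans (cong (_+ sumℕ (λ j → indicator (suc (β j) ≟ suc i))) (sumℕ-zero {b₀} (λ _ → refl))) (count i))

-- Labels of the points, their numbering, and the factors m + 1.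

Label : ℕ → ℕ → Set
Label r d = Fin (suc r) ⊎ (Fin d × Fin r)

module Labelling (r d : ℕ) where

  labelling : Fin (suc r ℕ.+ d ℕ.* r) ↔ Label r d
  labelling = (↔-id (Fin (suc r)) ⊎-↔ Fin.*↔× {d} {r}) ↔-∘ Fin.+↔⊎

  label : Fin (suc r ℕ.+ d ℕ.* r) → Label r d
  label = Inverse.to labelling

  index : Label r d → Fin (suc r ℕ.+ d ℕ.* r)
  index = Inverse.from labelling

  index∘label : ∀ i → index (label i) ≡ i
  index∘label = Inverse.strictlyInverseʳ labelling

module _ where
  open import Data.Rational using (_+_; _-_; -_; _≤_; _<_)

  -- The rational m + 1; the shift makes every factor at least 1.
  scale : ℕ → ℚ
  scale zero    = 1ℚ
  scale (suc m) = 1ℚ + scale m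

  1≤scale : ∀ m → 1ℚ ≤ scale m
  1≤scale zero    = ℚ.≤-refl
  1≤scale (suc m) = subst (_≤ scale (suc m)) (ℚ.+-identityʳ 1ℚ)
    (ℚ.+-monoʳ-≤ 1ℚ (ℚ.≤-trans (ℚ.<⇒≤ (ℚ.positive⁻¹ 1ℚ)) (1≤scale m)))

  0<scale : ∀ m → 0ℚ < scale m
  0<scale m = ℚ.<-≤-trans (ℚ.positive⁻¹ 1ℚ) (1≤scale m)

  0≤scale : ∀ m → 0ℚ ≤ scale m
  0≤scale m = ℚ.<⇒≤ (0<scale m)

  -scale<0 : ∀ m → - scale m < 0ℚ
  -scale<0 m = ℚ.neg-antimono-< (0<scale m)

  scale-injective : ∀ m n → scale m ≡ scale n → m ≡ n
  scale-injective zero    zero    eq = refl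
  scale-injective zero    (suc n) eq = contradiction (ℚ.+-monoʳ-< 1ℚ (0<scale n)) (ℚ.<-irrefl (trans (ℚ.+-identityʳ 1ℚ) eq))
  scale-injective (suc m) zero    eq = contradiction (ℚ.+-monoʳ-< 1ℚ (0<scale m)) (ℚ.<-irrefl (trans (ℚ.+-identityʳ 1ℚ) (sym eq)))
  scale-injective (suc m) (suc n) eq = cong suc (scale-injective m n (ℚ-+-cancelˡ 1ℚ (scale m) (scale n) eq))

-- For n points and r + 1 parts this is n + d = (r + 1)(d + 1), so the codimensions sum to d exactly
-- when the sizes sum to n.
count-identity : ∀ r d → suc r ℕ.+ d ℕ.* r ℕ.+ d ≡ suc r ℕ.* suc d
count-identity = solve 2
  (λ r d → con 1 :+ r :+ d :* r :+ d := (con 1 :+ r) :* (con 1 :+ d)) refl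
  where open ℕ-Solver using (solve; _:=_; _:+_; _:*_; con)

-- The point configuration.

module Configuration {r d : ℕ} (β : Fin d → Fin (suc r)) where
  open Labelling r d
  open import Data.Rational using (_+_; _-_; -_; _≤_; _<_)

  -- `inj₁ i` is the centre of colour i, and `inj₂ (j , m)` is the point (m + 1) e_j. The factor i +
  -- 1 on a centre keeps apart the centres of colours that β does not use, which all lie on one ray.
  position : Label r d → Vector ℚ d
  position (inj₁ i)       c = if does (β c ≟ i) then 0ℚ else - scale (toℕ i)
  position (inj₂ (j , m)) c = if does (j ≟ c) then scale (toℕ m) else 0ℚ

  centre-coloured : ∀ {i c} → β c ≡ i → position (inj₁ i) c ≡ 0ℚ
  centre-coloured {i} {c} βc≡i with β c ≟ i
  ... | yes _    = refl
  ... | no  βc≢i = contradiction βc≡i βc≢i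

  centre-uncoloured : ∀ {i c} → β c ≢ i → position (inj₁ i) c ≡ - scale (toℕ i)
  centre-uncoloured {i} {c} βc≢i with β c ≟ i
  ... | yes βc≡i = contradiction βc≡i βc≢i
  ... | no  _    = refl

  axis-on : ∀ c m → position (inj₂ (c , m)) c ≡ scale (toℕ m)
  axis-on c m with c ≟ c
  ... | yes _   = refl
  ... | no  c≢c = contradiction refl c≢c

  axis-off : ∀ {j c} m → j ≢ c → position (inj₂ (j , m)) c ≡ 0ℚ
  axis-off {j} {c} m j≢c with j ≟ c
  ... | yes j≡c = contradiction j≡c j≢c
  ... | no  _   = refl

  centre≤0 : ∀ i c → position (inj₁ i) c ≤ 0ℚ
  centre≤0 i c with β c ≟ i
  ... | yes _ = ℚ.≤-refl
  ... | no  _ = ℚ.<⇒≤ (-scale<0 (toℕ i))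

  -scale≤centre : ∀ i c → - scale (toℕ i) ≤ position (inj₁ i) c
  -scale≤centre i c with β c ≟ i
  ... | yes _ = ℚ.<⇒≤ (-scale<0 (toℕ i))
  ... | no  _ = ℚ.≤-refl

  0≤axis : ∀ j m c → 0ℚ ≤ position (inj₂ (j , m)) c
  0≤axis j m c with j ≟ c
  ... | yes _ = 0≤scale (toℕ m)
  ... | no  _ = ℚ.≤-refl

  1≤sum-axis : ∀ j m → 1ℚ ≤ sumℚ (position (inj₂ (j , m)))
  1≤sum-axis j m = ℚ.≤-trans (subst (1ℚ ≤_) (sym (axis-on j m)) (1≤scale (toℕ m)))
    (term≤sumℚ (position (inj₂ (j , m))) (0≤axis j m) j)

  -- The linear functional separating a part that avoids the axis c from 0: it is
  -- large at centres not coloured β c because x_c is their least coordinate, and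
  -- it equals the coordinate sum on the other axes.
  height : Fin d → Label r d → ℚ
  height c l = sumℚ (λ c′ → position l c′ - position l c) - position l c

  -- The differences in the sum are nonnegative, and the remaining term - x_c alone is i + 1.
  1≤height-centre : ∀ {i c} → β c ≢ i → 1ℚ ≤ height c (inj₁ i)
  1≤height-centre {i} {c} βc≢i = subst (λ q → 1ℚ ≤ sumℚ (λ c′ → position (inj₁ i) c′ - q) - q)
    (sym (centre-uncoloured βc≢i))
    (ℚ.≤-trans (1≤scale (toℕ i)) (ℚ.≤-trans
      (ℚ.≤-reflexive (trans (sym (ℚ-neg-involutive (scale (toℕ i)))) (sym (ℚ.+-identityˡ _))))
      (ℚ.+-monoˡ-≤ _ (sumℚ-nonNeg (λ c′ → position (inj₁ i) c′ - - scale (toℕ i))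
        (λ c′ → 0≤q-p (-scale≤centre i c′))))))

  1≤height-axis : ∀ {j c} m → j ≢ c → 1ℚ ≤ height c (inj₂ (j , m))
  1≤height-axis {j} {c} m j≢c = subst (1ℚ ≤_) sum≡height (1≤sum-axis j m)
    where
    x = position (inj₂ (j , m))
    sum≡height : sumℚ x ≡ height c (inj₂ (j , m))
    sum≡height = trans (sym (ℚ.+-identityʳ (sumℚ x))) (subst
      (λ q → sumℚ x + 0ℚ ≡ sumℚ (λ c′ → x c′ - q) - q) (sym (axis-off m j≢c))
      (cong (_- 0ℚ) (sumℚ-cong (λ c′ → sym (ℚ.+-identityʳ (x c′))))))

  -- Two centres that agree at coordinate 0 have the same scale there, unless both
  -- vanish, and then both are the one of colour β 0.
  position-injective : 1 ℕ.≤ d → ∀ l l′ → (∀ c → position l c ≡ position l′ c) → l ≡ l′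
  position-injective (ℕ.s≤s _) (inj₁ i) (inj₁ i′) eq with β zero ≟ i | β zero ≟ i′ | eq zero
  ... | yes β₀≡i | yes β₀≡i′ | _  = cong inj₁ (trans (sym β₀≡i) β₀≡i′)
  ... | yes _    | no  _     | e  = contradiction (-scale<0 (toℕ i′)) (ℚ.<-irrefl (sym e))
  ... | no  _    | yes _     | e  = contradiction (-scale<0 (toℕ i)) (ℚ.<-irrefl e)
  ... | no  _    | no  _     | e  = cong inj₁ (Fin.toℕ-injective (scale-injective _ _ (ℚ.neg-injective e)))
  position-injective _ (inj₁ i) (inj₂ (j , m)) eq = contradiction
    (ℚ.<-≤-trans (0<scale (toℕ m)) (subst (_≤ 0ℚ) (trans (eq j) (axis-on j m)) (centre≤0 i j)))
    (ℚ.<-irrefl refl)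
  position-injective _ (inj₂ (j , m)) (inj₁ i) eq = contradiction
    (ℚ.<-≤-trans (0<scale (toℕ m)) (subst (_≤ 0ℚ) (trans (sym (eq j)) (axis-on j m)) (centre≤0 i j)))
    (ℚ.<-irrefl refl)
  position-injective _ (inj₂ (j , m)) (inj₂ (j′ , m′)) eq with j′ ≟ j | trans (sym (axis-on j m)) (eq j)
  ... | yes refl | e = cong (λ m → inj₂ (j , m)) (Fin.toℕ-injective (scale-injective _ _ e))
  ... | no  _    | e = contradiction (0<scale (toℕ m)) (ℚ.<-irrefl (sym e))

  points : Vector (Point d) (suc r ℕ.+ d ℕ.* r)
  points i c = fromℚ (position (label i) c)

  points-injective : 1 ℕ.≤ d → Injective _≡_ _≋_ points
  points-injective 1≤d {i} {i′} eq = begin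
    i                  ≡⟨ index∘label i ⟨
    index (label i)    ≡⟨ cong index (position-injective 1≤d (label i) (label i′) (λ c → fromℚ-injective (eq c))) ⟩
    index (label i′)   ≡⟨ index∘label i′ ⟩
    i′                 ∎
    where open ≡-Reasoning

  -- Tverberg partitions of the configuration.

  module _ {P : Vector (Subset (suc r ℕ.+ d ℕ.* r)) (suc r)} (T : TverbergPartition points P) where
    open TverbergPartition T

    private
      p : Point d
      p = proj₁ meet

      weight : Fin (suc r) → Vector ℝ _
      weight k = proj₁ (proj₂ meet k)

    infix 4 _∈ₗ_ _∈ₗ?_
    _∈ₗ_ : Label r d → Fin (suc r) → Set
    l ∈ₗ k = index l ∈ P k

    _∈ₗ?_ : ∀ l k → Dec (l ∈ₗ k)
    l ∈ₗ? k = index l ∈? P k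

    same-part : ∀ {i k l} → i ∈ P k → i ∈ P l → k ≡ l
    same-part {i} {k} {l} i∈Pk i∈Pl with k ≟ l
    ... | yes k≡l = k≡l
    ... | no  k≢l = contradiction (i , x∈p∩q⁺ (i∈Pk , i∈Pl)) (disjoint k l k≢l)

    nonNeg-on-part : ∀ k {y : Label r d → ℚ} {q} → Extends (weight k) (y ∘ label) q →
      (∀ l → l ∈ₗ k → 0ℚ ≤ y l) → NonNeg q
    nonNeg-on-part k e y≥0 = let _ , w≥0 , w≃0 , _ = proj₂ meet k in
      Extends-nonNeg (weight k) w≥0 w≃0 e (λ i i∈Pk → y≥0 (label i) (subst (_∈ P k) (sym (index∘label i)) i∈Pk))

    extends-coordinate : ∀ k c → Extends (weight k) (λ i → position (label i) c) (seq (p c))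
    extends-coordinate k = let _ , _ , _ , _ , wx≋p = proj₂ meet k in
      Extends-coordinate (weight k) {x = position ∘ label} {p} wx≋p

    -- Lets a functional that is at least 1 on a part be treated as a nonnegative one; against a
    -- value at most 0 at p this would make -1 nonnegative.
    extends-minus-1 : ∀ k {y q} → Extends (weight k) y q →
      Extends (weight k) (λ i → y i - 1ℚ) (λ m → q m - 1ℚ)
    extends-minus-1 k e = let _ , _ , _ , w≃1 , _ = proj₂ meet k in
      Extends-+ (weight k) e (Extends-neg (weight k) (Extends-1 (weight k) w≃1))

    -- Pigeonhole: choosing a point of the axis from each of the r + 1 disjoint parts would embed
    -- `Fin (suc r)` in `Fin r`.
    part-missing-axis : ∀ c → ∃ λ k → ∀ m → ¬ inj₂ (c , m) ∈ₗ k
    part-missing-axis c with Fin.¬∀⟶∃¬ (suc r) _ (λ k → Fin.any? (λ m → inj₂ (c , m) ∈ₗ? k)) ¬all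
      where
      ¬all : ¬ (∀ k → ∃ λ m → inj₂ (c , m) ∈ₗ k)
      ¬all on = ℕ.1+n≰n (Fin.injective⇒≤ {f = proj₁ ∘ on} (λ {k} {k′} eq →
        same-part (subst (λ m → inj₂ (c , m) ∈ₗ k) eq (proj₂ (on k))) (proj₂ (on k′))))
    ... | k , none = k , λ m m∈ → none (m , m∈)

    meet≤0 : ∀ c → NonNeg (λ m → - seq (p c) m)
    meet≤0 c with part-missing-axis c
    -- This part has only centres and points of other axes, and x_c ≤ 0 at all of these.
    ... | k , none = nonNeg-on-part k {λ l → - position l c}
      (Extends-neg (weight k) (extends-coordinate k c)) nonPos
      where
      nonPos : ∀ l → l ∈ₗ k → 0ℚ ≤ - position l c
      nonPos (inj₁ i) _ = 0≤-p (centre≤0 i c)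
      nonPos (inj₂ (j , m)) l∈ with j ≟ c
      ... | yes refl = contradiction l∈ (none m)
      ... | no  _    = ℚ.≤-refl

    part-has-centre : ∀ k → ∃ λ i → inj₁ i ∈ₗ k
    part-has-centre k with Fin.any? (λ i → inj₁ i ∈ₗ? k)
    ... | yes has  = has
    -- On the part the coordinate sum is at least 1, while at p each coordinate, hence the sum, is
    -- at most 0.
    ... | no  none = contradiction
      (NonNeg-resp-≗ cancel
        (NonNeg-+ (nonNeg-on-part k {λ l → sumℚ (position l) - 1ℚ}
            (extends-minus-1 k (Extends-sum (weight k) (extends-coordinate k))) large)
          (NonNeg-sum (λ c m → - seq (p c) m) meet≤0)))
      (¬NonNeg-const (ℚ.negative⁻¹ (- 1ℚ)))
      where
      large : ∀ l → l ∈ₗ k → 0ℚ ≤ sumℚ (position l) - 1ℚ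
      large (inj₁ i)       l∈ = contradiction (i , l∈) none
      large (inj₂ (j , m)) _  = 0≤q-p (1≤sum-axis j m)
      cancel : ∀ m → (sumℚ (λ c → seq (p c) m) - 1ℚ) + sumℚ (λ c → - seq (p c) m) ≡ - 1ℚ
      cancel m = trans (cong (sumℚ (λ c → seq (p c) m) - 1ℚ +_) (sumℚ-neg (λ c → seq (p c) m)))
        (p+q-p≡q (sumℚ (λ c → seq (p c) m)) (- 1ℚ))

    centre : Fin (suc r) → Fin (suc r)
    centre k = proj₁ (part-has-centre k)

    centre∈part : ∀ k → inj₁ (centre k) ∈ₗ k
    centre∈part k = proj₂ (part-has-centre k)

    centre-injective : Injective _≡_ _≡_ centre
    centre-injective {k} {k′} eq =
      same-part (subst (λ i → inj₁ i ∈ₗ k) eq (centre∈part k)) (centre∈part k′)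

    -- There are as many centres as parts, so the chosen centres exhaust them: i was chosen for some
    -- part, and disjointness makes that part k.
    centre-unique : ∀ {i k} → inj₁ i ∈ₗ k → i ≡ centre k
    centre-unique {i} {k} i∈ with injective⇒surjective centre-injective i
    ... | k′ , refl = cong centre (same-part (centre∈part k′) i∈)

    meet≃0 : ∀ c → Null (seq (p c))
    meet≃0 c with injective⇒surjective centre-injective (β c)
    -- The only centre in this part has colour β c and so vanishes at c; axis points are nonnegative
    -- at every coordinate.
    ... | k , centre≡βc = nonNeg-on-part k {λ l → position l c} (extends-coordinate k c) nonNegative , meet≤0 c
      where
      nonNegative : ∀ l → l ∈ₗ k → 0ℚ ≤ position l c
      nonNegative (inj₁ i) l∈ = ℚ.≤-reflexive (sym
        (centre-coloured {i} {c} (trans (sym centre≡βc) (sym (centre-unique l∈)))))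
      nonNegative (inj₂ (j , m)) _ = 0≤axis j m c

    -- Otherwise `height c` would be at least 1 on the whole part, whose only centre is not coloured
    -- β c; but its value at p tends to 0.
    part-has-axis : ∀ k c → β c ≢ centre k → ∃ λ m → inj₂ (c , m) ∈ₗ k
    part-has-axis k c βc≢centre with Fin.any? (λ m → inj₂ (c , m) ∈ₗ? k)
    ... | yes has  = has
    ... | no  none = contradiction
      (NonNeg-resp-≗ (λ m → cancel (q m))
        (NonNeg-+ (nonNeg-on-part k {λ l → height c l - 1ℚ} extends-height large) (proj₂ q≃0)))
      (¬NonNeg-const (ℚ.negative⁻¹ (- 1ℚ)))
      where
      -- The value of `height c` at p, a combination of coordinates that tend to 0.
      q : ℕ → ℚ
      q m = sumℚ (λ c′ → seq (p c′) m - seq (p c) m) - seq (p c) m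
      q≃0 : Null q
      q≃0 = Null-+ (Null-sum _ (λ c′ → Null-+ (meet≃0 c′) (Null-neg (meet≃0 c)))) (Null-neg (meet≃0 c))
      extends-height : Extends (weight k) (λ i → height c (label i) - 1ℚ) (λ m → q m - 1ℚ)
      extends-height = extends-minus-1 k (Extends-+ (weight k)
        (Extends-sum (weight k) (λ c′ → Extends-+ (weight k) (extends-coordinate k c′) neg)) neg)
        where neg = Extends-neg (weight k) (extends-coordinate k c)
      large : ∀ l → l ∈ₗ k → 0ℚ ≤ height c l - 1ℚ
      large (inj₁ i) l∈ =
        0≤q-p (1≤height-centre (λ βc≡i → βc≢centre (trans βc≡i (centre-unique l∈))))
      large (inj₂ (j , m)) l∈ =
        0≤q-p (1≤height-axis {j} {c} m (λ { refl → contradiction (m , l∈) none }))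
      cancel : ∀ z → (z - 1ℚ) + - z ≡ - 1ℚ
      cancel z = p+q-p≡q z (- 1ℚ)

    -- The centre of the part pays for the 1, and each coordinate c is paid for either by a point of
    -- the part on the axis c or by c itself having the colour of that centre.
    1+d≤size+colour-class : ∀ k →
      suc d ℕ.≤ ∣ P k ∣ ℕ.+ sumℕ (λ c → indicator (β c ≟ centre k))
    1+d≤size+colour-class k = begin
      suc d
        ≡⟨ cong suc (trans (sumℕ-const d {t = λ _ → 1} (λ _ → refl)) (ℕ.*-identityʳ d)) ⟨
      1 ℕ.+ sumℕ {d} (λ _ → 1)
        ≤⟨ ℕ.+-mono-≤
          (ℕ.≤-trans (1≤indicator (inj₁ (centre k) ∈ₗ? k) (centre∈part k))
            (term≤sumℕ (λ i → indicator (inj₁ i ∈ₗ? k)) (centre k)))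
          (sumℕ-mono-≤ one-per-coordinate) ⟩
      sumℕ centres ℕ.+ sumℕ (λ c → sumℕ (axes c) ℕ.+ class c)
        ≡⟨ cong (sumℕ centres ℕ.+_) (sumℕ-distrib-+ (sumℕ ∘ axes) class) ⟩
      sumℕ centres ℕ.+ (sumℕ (sumℕ ∘ axes) ℕ.+ sumℕ class)
        ≡⟨ ℕ.+-assoc (sumℕ centres) (sumℕ (sumℕ ∘ axes)) (sumℕ class) ⟨
      sumℕ centres ℕ.+ sumℕ (sumℕ ∘ axes) ℕ.+ sumℕ class
        ≡⟨ cong (λ a → sumℕ centres ℕ.+ a ℕ.+ sumℕ class) (sumℕ-combine d {r} (λ i → member (suc r ↑ʳ i))) ⟨
      sumℕ centres ℕ.+ sumℕ (λ i → member (suc r ↑ʳ i)) ℕ.+ sumℕ class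
        ≡⟨ cong (ℕ._+ sumℕ class) (trans (∣p∣≡sum (P k)) (sumℕ-split (suc r) member)) ⟨
      ∣ P k ∣ ℕ.+ sumℕ class ∎
      where
      open ℕ.≤-Reasoning
      member : Fin (suc r ℕ.+ d ℕ.* r) → ℕ
      member i = indicator (i ∈? P k)
      centres : Fin (suc r) → ℕ
      centres i = indicator (inj₁ i ∈ₗ? k)
      axes : Fin d → Fin r → ℕ
      axes c m = indicator (inj₂ (c , m) ∈ₗ? k)
      class : Fin d → ℕ
      class c = indicator (β c ≟ centre k)
      one-per-coordinate : ∀ c → 1 ℕ.≤ sumℕ (axes c) ℕ.+ class c
      one-per-coordinate c with β c ≟ centre k
      ... | yes _ = ℕ.m≤n+m 1 (sumℕ (axes c))
      ... | no  βc≢centre with part-has-axis k c βc≢centre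
      ...   | m , m∈ = ℕ.≤-trans
        (ℕ.≤-trans (1≤indicator (inj₂ (c , m) ∈ₗ? k) m∈) (term≤sumℕ (axes c) m))
        -- Off the colour class `class c` has reduced to 0.
        (ℕ.m≤m+n (sumℕ (axes c)) 0)

    -- The centre map serves as the permutation. The lower bounds, one per part, already add up to
    -- the upper bound n + d that disjointness gives, so each is an equality.
    sizes : ∀ {b} → (∀ i → sumℕ (λ c → indicator (β c ≟ i)) ≡ b i) → sumℕ b ≡ d →
      ∃ λ (σ : Permutation′ (suc r)) → ∀ k → ∣ P k ∣ ℕ.+ b (σ ⟨$⟩ʳ k) ≡ suc d
    sizes {b} class-size Σb≡d with injective⇒permutation centre-injective
    ... | σ , σ≗centre = σ , λ k → sym (sumℕ-tight lower upper k)
      where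
      lower : ∀ k → suc d ℕ.≤ ∣ P k ∣ ℕ.+ b (σ ⟨$⟩ʳ k)
      lower k = subst (λ z → suc d ℕ.≤ ∣ P k ∣ ℕ.+ z)
        (trans (class-size (centre k)) (cong b (sym (σ≗centre k)))) (1+d≤size+colour-class k)
      upper : sumℕ (λ k → ∣ P k ∣ ℕ.+ b (σ ⟨$⟩ʳ k)) ℕ.≤ sumℕ {suc r} (λ _ → suc d)
      upper = begin
        sumℕ (λ k → ∣ P k ∣ ℕ.+ b (σ ⟨$⟩ʳ k))
          ≡⟨ sumℕ-distrib-+ (λ k → ∣ P k ∣) (λ k → b (σ ⟨$⟩ʳ k)) ⟩
        sumℕ (λ k → ∣ P k ∣) ℕ.+ sumℕ (λ k → b (σ ⟨$⟩ʳ k))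
          ≡⟨ cong (sumℕ (λ k → ∣ P k ∣) ℕ.+_) (trans (sym (sumℕ-permute b σ)) Σb≡d) ⟩
        sumℕ (λ k → ∣ P k ∣) ℕ.+ d
          ≤⟨ ℕ.+-monoˡ-≤ d (sum∣disjoint∣≤n P same-part) ⟩
        suc r ℕ.+ d ℕ.* r ℕ.+ d
          ≡⟨ count-identity r d ⟩
        suc r ℕ.* suc d
          ≡⟨ sumℕ-const (suc r) (λ _ → refl) ⟨
        sumℕ {suc r} (λ _ → suc d) ∎
        where open ℕ.≤-Reasoning

-- From integer sizes to codimensions, and the theorem.

open import Data.Integer using (ℤ; +_) renaming (_≤_ to _≤ℤ_)

-- Moves from integer sizes to natural numbers, which `colouring` can use as block lengths; the
-- bound on a makes the absolute value equal to the difference.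
codimensions : ∀ {d r} (a : Vector ℤ r) → (∀ i → a i ℤ.≤ + suc d) →
  ∃ λ (b : Vector ℕ r) → (∀ i → a i ℤ.+ + b i ≡ + suc d) × sumℤ a ℤ.+ + sumℕ b ≡ + (r ℕ.* suc d)
codimensions {d} {zero} a a≤1+d = (λ ()) , (λ ()) , refl
codimensions {d} {suc r} a a≤1+d with codimensions (a ∘ suc) (a≤1+d ∘ suc)
... | b , a+b≡1+d , Σa+Σb = b₀ Vector.∷ b , (λ { zero → a₀+b₀ ; (suc i) → a+b≡1+d i }) ,
  trans (ℤ-interchange (a zero) (sumℤ (a ∘ suc)) (+ b₀) (+ sumℕ b)) (cong₂ ℤ._+_ a₀+b₀ Σa+Σb)
  where
  b₀ : ℕ
  b₀ = ℤ.∣ + suc d ℤ.- a zero ∣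
  a₀+b₀ : a zero ℤ.+ + b₀ ≡ + suc d
  a₀+b₀ = trans (cong (λ z → a zero ℤ.+ z) (ℤ.0≤i⇒+∣i∣≡i (ℤ.i≤j⇒0≤j-i (a≤1+d zero))))
    (trans (sym (ℤ.+-assoc (a zero) (+ suc d) (ℤ.- a zero))) (i+j-i≡j (a zero) (+ suc d)))

-- n is a variable tied by an equation, so that matching `refl` replaces it by the form in which the
-- labels are numbered: r + 1 centres, then d axes of r points.
tverberg-sizes : ∀ {d r n} → 1 ℕ.≤ d → n ≡ suc r ℕ.+ d ℕ.* r →
  (a : Vector ℤ (suc r)) → (∀ i → a i ℤ.≤ + suc d) → sumℤ a ≡ + n →
  ∃ λ (X : Vector (Point d) n) → Injective _≡_ _≋_ X ×
    (∀ (P : Vector (Subset n) (suc r)) → TverbergPartition X P →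
      ∃ λ (σ : Permutation′ (suc r)) → ∀ k → + ∣ P k ∣ ≡ a (σ ⟨$⟩ʳ k))
tverberg-sizes {d} {r} 1≤d refl a a≤1+d Σa≡n =
  points , points-injective 1≤d , λ P T → let σ , size = sizes T class-size Σb≡d in
    σ , λ k → ℤ-+-cancelʳ (+ b (σ ⟨$⟩ʳ k)) (+ ∣ P k ∣) (a (σ ⟨$⟩ʳ k))
      (trans (cong +_ (size k)) (sym (a+b≡1+d (σ ⟨$⟩ʳ k))))
  where
  n = suc r ℕ.+ d ℕ.* r
  b : Vector ℕ (suc r)
  b = proj₁ (codimensions a a≤1+d)
  a+b≡1+d : ∀ i → a i ℤ.+ + b i ≡ + suc d
  a+b≡1+d = proj₁ (proj₂ (codimensions a a≤1+d))
  n+Σb≡n+d : n ℕ.+ sumℕ b ≡ n ℕ.+ d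
  -- Both sides equal the sum of all aᵢ + bᵢ, which is (r + 1)(d + 1).
  n+Σb≡n+d = ℤ.+-injective (begin
    + n ℤ.+ + sumℕ b       ≡⟨ cong (ℤ._+ + sumℕ b) Σa≡n ⟨
    sumℤ a ℤ.+ + sumℕ b    ≡⟨ proj₂ (proj₂ (codimensions a a≤1+d)) ⟩
    + (suc r ℕ.* suc d)    ≡⟨ cong +_ (count-identity r d) ⟨
    + (n ℕ.+ d)            ∎)
    where open ≡-Reasoning
  Σb≡d : sumℕ b ≡ d
  Σb≡d = ℕ.+-cancelˡ-≡ n (sumℕ b) d n+Σb≡n+d
  β : Fin d → Fin (suc r)
  β = proj₁ (colouring b (sym Σb≡d))
  class-size : ∀ i → sumℕ (λ c → indicator (β c ≟ i)) ≡ b i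
  class-size = proj₂ (colouring b (sym Σb≡d))
  open Configuration β

open import Data.Nat using (_+_; _*_; _∸_; _≤_)

theorem1 : ∀ (d r : ℕ) → 1 ≤ d → 1 ≤ r →
    let n = (d + 1) * (r ∸ 1) + 1 in
    (a : Vector ℤ r) → (∀ i → a i ≤ℤ + (d + 1)) → sumℤ a ≡ + n →
    ∃ λ (X : Vector (Point d) n) →
    Injective _≡_ _≋_ X ×
    (∀ (P : Vector (Subset n) r) → TverbergPartition X P →
    ∃ λ (σ : Permutation′ r) → ∀ k → + ∣ P k ∣ ≡ a (σ ⟨$⟩ʳ k))
-- After this match `r ∸ 1` computes to the r of the construction.
theorem1 d (suc r) 1≤d _ a a≤d+1 = tverberg-sizes 1≤d
  (solve 2 (λ d r → (d :+ con 1) :* r :+ con 1 := con 1 :+ r :+ d :* r) refl d r)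
  a (λ i → subst (λ m → a i ≤ℤ + m) (ℕ.+-comm d 1) (a≤d+1 i))
  where open ℕ-Solver using (solve; _:=_; _:+_; _:*_; con)
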